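{- Let $a(1) = 1$ and $a(n) = a(\lfloor n/2 \rfloor) + \lfloor n/2 \rfloor$ for $n \ge 2$, and let $S(n) = \sum_{i=1}^{n} a(i)$ for $n \ge 0$ (so $S(0) = 0$). Then $S(n) \equiv 1 - m(n) \pmod 2$ for all $n \ge 0$.
   Context: For a non-negative integer $k$, $s_2(k)$ denotes the number of ones in the binary expansion of $k$. Define $\bar{t}(k) = 1$ if $s_2(k)$ is even and $\bar{t}(k)=0$ if $s_2(k)$ is odd. The sequence $m(n)$, $n \ge 0$, is defined by $m(2k) = \bar{t}(k)$ and $m(2k+1) = 0$ for all $k \ge 0$. The sequence $a$ is OEIS A113474 ($1,2,2,4,4,5,5,8,\ldots$, from $n=1$) and $S$ is OEIS A122248, indexed from $n=0$: $0,1,3,5,9,13,18,23,31,\ldots$. -}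

module Defs where

open import Data.Bool.Base using (if_then_else_)
open import Data.Digit using (toDigits; 1b)
open import Data.Fin.Properties using (_≟_)
open import Data.Integer.Base as ℤ using (ℤ)
open import Data.Integer.Divisibility as ℤ using ()
open import Data.List.Base using (filter; length)
open import Data.Nat.Base using (ℕ; zero; suc; 2+; _+_; _*_; _≤_; _<_; s≤s; ⌊_/2⌋)
open import Data.Nat.Divisibility using (_∣_; _∣?_; m∣m*n; ∣m+n∣m⇒∣n; ∣1⇒≡1)
open import Data.Nat.Induction using (Acc; acc; <-wellFounded)
open import Data.Nat.Properties using (⌊n/2⌋<n; +-identityʳ; n≡⌊n+n/2⌋)
open import Data.Product.Base using (proj₁)
open import Relation.Binary.PropositionalEquality using (_≡_; refl; sym; trans; cong)
open import Relation.Nullary.Decidable using (does; dec-true; dec-false)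
open import Relation.Nullary.Negation using (¬_)

s₂ : ℕ → ℕ
s₂ k = length (filter (_≟ 1b) (proj₁ (toDigits 2 k)))

t̄ : ℕ → ℕ
t̄ k = if does (2 ∣? s₂ k) then 1 else 0

m : ℕ → ℕ
m n = if does (2 ∣? n) then t̄ ⌊ n /2⌋ else 0

m-even : ∀ k → m (2 * k) ≡ t̄ k
m-even k rewrite dec-true (2 ∣? (2 * k)) (m∣m*n k) =
  cong t̄ (trans (cong (λ j → ⌊ k + j /2⌋) (+-identityʳ k)) (sym (n≡⌊n+n/2⌋ k)))

2∤2k+1 : ∀ k → ¬ 2 ∣ 2 * k + 1
2∤2k+1 k 2∣2k+1 with () ← ∣1⇒≡1 (∣m+n∣m⇒∣n 2∣2k+1 (m∣m*n k))

m-odd : ∀ k → m (2 * k + 1) ≡ 0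
m-odd k rewrite dec-false (2 ∣? (2 * k + 1)) (2∤2k+1 k) = refl

-- The sequence a starts at index 1; a 0 is a junk value, which S never uses.
aAcc : ∀ n → Acc _<_ n → ℕ
aAcc 0        _        = 0
aAcc 1        _        = 1
aAcc n@(2+ k) (acc rs) = aAcc ⌊ n /2⌋ (rs (⌊n/2⌋<n (suc k))) + ⌊ n /2⌋

a : ℕ → ℕ
a n = aAcc n (<-wellFounded n)

aAcc-irrelevant : ∀ n (p q : Acc _<_ n) → aAcc n p ≡ aAcc n q
aAcc-irrelevant 0        _        _        = refl
aAcc-irrelevant 1        _        _        = refl
aAcc-irrelevant n@(2+ k) (acc rs) (acc ss) =
  cong (_+ ⌊ n /2⌋) (aAcc-irrelevant ⌊ n /2⌋ (rs (⌊n/2⌋<n (suc k))) (ss (⌊n/2⌋<n (suc k))))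

a-one : a 1 ≡ 1
a-one = refl

a-rec : ∀ n → 2 ≤ n → a n ≡ a ⌊ n /2⌋ + ⌊ n /2⌋
a-rec 1        (s≤s ())
a-rec n@(2+ _) _ with acc rs ← <-wellFounded n =
  cong (_+ ⌊ n /2⌋) (aAcc-irrelevant ⌊ n /2⌋ _ _)

S : ℕ → ℕ
S zero    = 0
S (suc n) = S n + a (suc n)

infix 4 _≡_[mod_]

_≡_[mod_] : ℤ → ℤ → ℤ → Set
x ≡ y [mod k ] = k ℤ.∣ (x ℤ.- y)

{-# OPTIONS --safe #-}
module Submission where

-- Summing digit by digit gives a(n) = n + 1 - s₂(n) for n ≥ 1. Since
-- a(2k) = a(2k+1), the terms of S(2k+1) after a(1) = 1 cancel in pairs mod 2, so
-- S(2k+1) is odd; subtracting a(2k+1) = 2k + 1 - s₂(k) gives S(2k) ≡ s₂(k).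

open import Defs
open import Data.Nat.Base using (ℕ)
open import Data.Integer.Base using (+_; _-_)
open import Data.Bool.Base using (if_then_else_)
open import Data.Digit using (Expansion; fromDigits; toDigits; 1b)
open import Data.Fin.Base using (zero; suc)
open import Data.Fin.Properties using (_≟_)
import Data.Integer.Base as ℤ
import Data.Integer.Divisibility.Signed as Signed
open import Data.Integer.Tactic.RingSolver using () renaming (solve-∀ to ℤ-solve-∀)
open import Data.List.Base using ([]; _∷_; filter; length)
open import Data.Nat.Base using (zero; suc; 2+; _+_; _*_; _⊓_; ⌊_/2⌋; s≤s; z≤n)
open import Data.Nat.DivMod using (_divMod_; result)
open import Data.Nat.Divisibility
  using (_∣_; _∣?_; divides; ∣m∣n⇒∣m+n; ∣m+n∣m⇒∣n; ∣-refl; m∣m*n; n∣m*n)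
open import Data.Nat.Properties using (+-identityʳ; +-comm; *-comm)
open import Data.Nat.Tactic.RingSolver using (solve-∀)
open import Data.Product.Base using (_,_)
open import Relation.Binary.PropositionalEquality
  using (_≡_; refl; sym; trans; cong; subst; module ≡-Reasoning)
open import Relation.Nullary.Decidable using (does; yes; no; dec-true; dec-false)
open import Relation.Nullary.Negation using (¬_; contradiction)

2∤n⇒2∣1+n : ∀ n → ¬ 2 ∣ n → 2 ∣ 1 + n
2∤n⇒2∣1+n n 2∤n with n divMod 2
... | result q zero       refl = contradiction (n∣m*n q) 2∤n
... | result q (suc zero) refl = n∣m*n (suc q)

⌊k*2/2⌋≡k : ∀ k → ⌊ k * 2 /2⌋ ≡ k
⌊k*2/2⌋≡k zero    = refl
⌊k*2/2⌋≡k (suc k) = cong suc (⌊k*2/2⌋≡k k)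

⌊1+k*2/2⌋≡k : ∀ k → ⌊ suc (k * 2) /2⌋ ≡ k
⌊1+k*2/2⌋≡k zero    = refl
⌊1+k*2/2⌋≡k (suc k) = cong suc (⌊1+k*2/2⌋≡k k)

-- The factor 2 stands on the right because `fromDigits` and `divMod` produce numbers in that form;
-- `suc k` keeps the argument of `a` at least 2, where the recursion applies.
a-even : ∀ k → a (suc k * 2) ≡ a (suc k) + suc k
a-even k = trans (a-rec (suc k * 2) (s≤s (s≤s z≤n)))
                 (cong (λ j → a j + j) (⌊k*2/2⌋≡k (suc k)))

a-odd : ∀ k → a (suc (suc k * 2)) ≡ a (suc k) + suc k
a-odd k = trans (a-rec (suc (suc k * 2)) (s≤s (s≤s z≤n)))
                (cong (λ j → a j + j) (⌊1+k*2/2⌋≡k (suc k)))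

-- The count from `s₂` on an arbitrary digit list, so that induction over the digits is possible.
ones : Expansion 2 → ℕ
ones ds = length (filter (_≟ 1b) ds)

-- The minimum 1 ⊓ n makes the identity a(n) = n + 1 - s₂(n) hold also at the
-- junk value a 0 = 0, so that leading zeros of ds need no special treatment.
a+ones : ∀ n (ds : Expansion 2) → fromDigits ds ≡ n → a n + ones ds ≡ n + 1 ⊓ n
a+ones _ []                refl = refl
a+ones _ (zero ∷ ds)       refl with fromDigits ds | a+ones _ ds refl
... | zero  | ih = ih
... | suc k | ih rewrite a-even k = begin
  (a (suc k) + suc k) + ones ds  ≡⟨ shift (a (suc k)) (suc k) (ones ds) ⟩
  (a (suc k) + ones ds) + suc k  ≡⟨ cong (_+ suc k) ih ⟩
  (suc k + 1) + suc k            ≡⟨ double k ⟩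
  suc k * 2 + 1                  ∎
  where
  open ≡-Reasoning
  shift : ∀ x y z → (x + y) + z ≡ (x + z) + y
  shift = solve-∀
  double : ∀ k → (suc k + 1) + suc k ≡ suc k * 2 + 1
  double = solve-∀
a+ones _ (suc zero ∷ ds) refl with fromDigits ds | a+ones _ ds refl
-- The number is 1 and `ih` says that `ds` contains no ones; the 2 comes from `a 1` and the leading
-- digit of the list.
... | zero  | ih = cong 2+ ih
... | suc k | ih rewrite a-odd k = begin
  (a (suc k) + suc k) + suc (ones ds)  ≡⟨ shift (a (suc k)) (suc k) (ones ds) ⟩
  suc ((a (suc k) + ones ds) + suc k)  ≡⟨ cong (λ j → suc (j + suc k)) ih ⟩
  suc ((suc k + 1) + suc k)            ≡⟨ double k ⟩
  suc (suc k * 2) + 1                  ∎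
  where
  open ≡-Reasoning
  shift : ∀ x y z → (x + y) + suc z ≡ suc ((x + z) + y)
  shift = solve-∀
  double : ∀ k → suc ((suc k + 1) + suc k) ≡ suc (suc k * 2) + 1
  double = solve-∀

-- `toDigits` returns its digits with a proof that they represent the number, and `1 ⊓ n` is 1 for
-- positive n.
a+s₂ : ∀ k → a (suc k) + s₂ (suc k) ≡ suc k + 1
a+s₂ k with ds , eq ← toDigits 2 (suc k) = a+ones (suc k) ds eq

-- Each induction step adds two equal terms of `a`, hence an even amount.
S-odd : ∀ k → 2 ∣ 1 + S (suc (k * 2))
S-odd zero    = ∣-refl
S-odd (suc k) rewrite a-even k | a-odd k =
  subst (2 ∣_) (pair (S (suc (k * 2))) (a (suc k) + suc k))
    (∣m∣n⇒∣m+n (S-odd k) (m∣m*n (a (suc k) + suc k)))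
  where
  pair : ∀ x b → (1 + x) + 2 * b ≡ 1 + ((x + b) + b)
  pair = solve-∀

S-even : ∀ k → 2 ∣ S (k * 2) + s₂ k
S-even zero    = divides 0 refl
S-even (suc k) =
  -- Adding `2 * s` avoids subtraction: one `s` turns `b` into `suc k + 1` by `a+s₂`, the other
  -- stays with `x`, and the remaining even summand `2 * (suc k + 1)` is cancelled.
  ∣m+n∣m⇒∣n (subst (2 ∣_) regroup (∣m∣n⇒∣m+n (S-odd (suc k)) (m∣m*n s)))
            (m∣m*n (suc k + 1))
  where
  open ≡-Reasoning
  b = a (suc k)
  s = s₂ (suc k)
  x = S (suc k * 2)
  gather : ∀ x b s j → (1 + (x + (b + j))) + 2 * s ≡ (b + s) + (j + 1) + (x + s)
  gather = solve-∀
  double : ∀ j y → (j + 1) + (j + 1) + y ≡ 2 * (j + 1) + y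
  double = solve-∀
  regroup : (1 + (x + a (suc (suc k * 2)))) + 2 * s ≡ 2 * (suc k + 1) + (x + s)
  regroup = begin
    (1 + (x + a (suc (suc k * 2)))) + 2 * s  ≡⟨ cong (λ j → (1 + (x + j)) + 2 * s) (a-odd k) ⟩
    (1 + (x + (b + suc k))) + 2 * s          ≡⟨ gather x b s (suc k) ⟩
    (b + s) + (suc k + 1) + (x + s)          ≡⟨ cong (λ j → j + (suc k + 1) + (x + s)) (a+s₂ k) ⟩
    (suc k + 1) + (suc k + 1) + (x + s)      ≡⟨ double (suc k) (x + s) ⟩
    2 * (suc k + 1) + (x + s)                ∎

-- For n = `s₂ k` the conditional is `t̄ k` by definition; a general n keeps the case split away
-- from the digit computation.
n+[2∣n]-odd : ∀ n → 2 ∣ 1 + (n + (if does (2 ∣? n) then 1 else 0))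
n+[2∣n]-odd n with 2 ∣? n
... | yes 2∣n rewrite dec-true (2 ∣? n) 2∣n | +-comm n 1 = ∣m∣n⇒∣m+n ∣-refl 2∣n
... | no  2∤n rewrite dec-false (2 ∣? n) 2∤n | +-identityʳ n = 2∤n⇒2∣1+n n 2∤n

s₂+t̄-odd : ∀ k → 2 ∣ 1 + (s₂ k + t̄ k)
s₂+t̄-odd k = n+[2∣n]-odd (s₂ k)

m[k*2]≡t̄[k] : ∀ k → m (k * 2) ≡ t̄ k
m[k*2]≡t̄[k] k = trans (cong m (*-comm k 2)) (m-even k)

m[1+k*2]≡0 : ∀ k → m (suc (k * 2)) ≡ 0
m[1+k*2]≡0 k = trans (cong m (1+k*2≡2*k+1 k)) (m-odd k)
  where
  1+k*2≡2*k+1 : ∀ k → suc (k * 2) ≡ 2 * k + 1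
  1+k*2≡2*k+1 = solve-∀

-- Adding the two preceding parity facts gives `s₂ k` the coefficient 2, so it drops out.
S+t̄-odd : ∀ k → 2 ∣ 1 + (S (k * 2) + t̄ k)
S+t̄-odd k =
  ∣m+n∣m⇒∣n (subst (2 ∣_) (regroup (S (k * 2)) (s₂ k) (t̄ k))
                   (∣m∣n⇒∣m+n (S-even k) (s₂+t̄-odd k)))
            (m∣m*n (s₂ k))
  where
  regroup : ∀ x s t → (x + s) + (1 + (s + t)) ≡ 2 * s + (1 + (x + t))
  regroup = solve-∀

S+m-odd : ∀ n → 2 ∣ 1 + (S n + m n)
S+m-odd n with n divMod 2
... | result k zero       refl =
  subst (λ j → 2 ∣ 1 + (S (k * 2) + j)) (sym (m[k*2]≡t̄[k] k)) (S+t̄-odd k)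
... | result k (suc zero) refl =
  subst (λ j → 2 ∣ 1 + j)
    (trans (sym (+-identityʳ _)) (cong (λ j → S (suc (k * 2)) + j) (sym (m[1+k*2]≡0 k))))
    (S-odd k)

lemma11 : (n : ℕ) → + S n ≡ + 1 - + m n [mod + 2 ]
-- The difference S n - (1 - m n) is 1 + (S n + m n) minus 2; signed divisibility admits the summand
-- -2 = -1 * 2.
lemma11 n = Signed.∣⇒∣ᵤ (subst (+ 2 Signed.∣_) (rearrange (+ S n) (+ m n))
  (Signed.∣m∣n⇒∣m+n (Signed.∣ᵤ⇒∣ {+ 2} {+ (1 + (S n + m n))} (S+m-odd n))
                    (Signed.divides (ℤ.- + 1) refl)))
  where
  rearrange : ∀ x y → (+ 1 ℤ.+ (x ℤ.+ y)) ℤ.+ ℤ.- + 2 ≡ x - (+ 1 - y)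
  rearrange = ℤ-solve-∀
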